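{- For every $n\ge 4$, $|\mathrm{Sort}_n(123,321)|=7\cdot 2^{n-4}$.
   Context: A permutation $x$ contains a pattern $p$ if it has a subsequence order-isomorphic to $p$; otherwise it avoids $p$. For a set $T$ of patterns, the map $s_T$ is defined as follows: the entries of the input permutation $x=x_1\cdots x_n$ are read from left to right, with an initially empty stack. At each step, if the input is nonempty and pushing the next input entry onto the stack produces a stack whose contents, read from top to bottom, avoid every pattern in $T$, that entry is pushed; otherwise the top entry of the stack is popped and appended to the output. When the input is exhausted, the remaining stack entries are popped one at a time to the output. $s_T(x)$ is the output word. Write $s_{\sigma,\tau}=s_{\{\sigma,\tau\}}$ and $s=s_{\{21\}}$ (West's stack-sorting map, whose stack is increasing from top to bottom). $\mathrm{Sort}_n(\sigma,\tau)$ is the set of $x\in S_n$ such that $s(s_{\sigma,\tau}(x))=12\cdots n$. -}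

module Defs where

open import Data.Bool using (if_then_else_)
open import Data.Fin using (Fin; cast)
open import Data.Fin.Properties using (all?)
open import Data.List using (List; []; _∷_; length; lookup; map; upTo)
open import Data.List.Membership.Propositional using (_∈_)
open import Data.List.Relation.Binary.Permutation.Propositional using (_↭_)
open import Data.List.Relation.Binary.Sublist.Propositional using (_⊆_; []; _∷_; _∷ʳ_)
import Data.List.Relation.Unary.All as All
open import Data.List.Relation.Unary.Unique.Propositional using (Unique)
open import Data.Nat using (ℕ; suc; _<_; _<?_; _≟_)
open import Data.Product using (Σ; ∃; _×_; _,_)
open import Data.Sum using ([_,_]; inj₁; inj₂)
open import Function using (_∘_; _⇔_; mk⇔; Equivalence)
open import Level using (0ℓ)
open import Relation.Binary.PropositionalEquality using (_≡_; refl)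
open import Relation.Nullary using (¬_; Dec; does; yes; no; ¬?)
open import Relation.Nullary.Decidable using (map′; _⊎-dec_; _→-dec_; _×-dec_)
open import Relation.Unary using (Pred; Decidable)

Word : Set
Word = List ℕ

-- 1 2 ⋯ n
identity : ℕ → Word
identity n = map suc (upTo n)

-- x ∈ Sₙ, in one-line notation
IsPerm : ℕ → Word → Set
IsPerm n x = x ↭ identity n

OrderIso : Word → Word → Set
OrderIso u v = Σ (length u ≡ length v) λ eq → ∀ (i j : Fin (length u)) →
  (lookup u i < lookup u j) ⇔ (lookup v (cast eq i) < lookup v (cast eq j))

Contains : Word → Word → Set
Contains x p = ∃ λ y → (y ⊆ x) × OrderIso y p

Avoids : Word → Word → Set
Avoids x p = ¬ Contains x p

AvoidsAll : List Word → Word → Set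
AvoidsAll T x = All.All (Avoids x) T

_⇔-dec_ : ∀ {A B : Set} → Dec A → Dec B → Dec (A ⇔ B)
a? ⇔-dec b? = map′ (λ (f , g) → mk⇔ f g)
                   (λ e → Equivalence.to e , Equivalence.from e)
                   ((a? →-dec b?) ×-dec (b? →-dec a?))

orderIso? : ∀ u v → Dec (OrderIso u v)
orderIso? u v with length u ≟ length v
... | no  ne = no λ (eq , _) → ne eq
... | yes eq = map′ (eq ,_) (λ (_ , h) → h)
  (all? λ i → all? λ j → (lookup u i <? lookup u j)
                  ⇔-dec (lookup v (cast eq i) <? lookup v (cast eq j)))

anySublist? : ∀ {P : Pred Word 0ℓ} → Decidable P → ∀ x → Dec (∃ λ y → (y ⊆ x) × P y)
anySublist? P? [] = map′ (λ p → [] , [] , p) (λ { (_ , [] , p) → p }) (P? [])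
anySublist? P? (a ∷ x) = map′
  [ (λ (y , s , p) → a ∷ y , refl ∷ s , p) , (λ (y , s , p) → y , a ∷ʳ s , p) ]
  (λ { (_ , refl ∷ s , p) → inj₁ (_ , s , p) ; (y , _ ∷ʳ s , p) → inj₂ (y , s , p) })
  (anySublist? (P? ∘ (a ∷_)) x ⊎-dec anySublist? P? x)

contains? : ∀ x p → Dec (Contains x p)
contains? x p = anySublist? (λ y → orderIso? y p) x

avoidsAll? : ∀ T x → Dec (AvoidsAll T x)
avoidsAll? T x = All.all? (λ p → ¬? (contains? x p)) T

-- run T input stack is the output still to be produced; the head of the
-- stack is its top, so a stack as a list is read from top to bottom.
-- The machine is blocked with an empty stack only if T contains a pattern of
-- length at most 1; it then halts.
run : List Word → Word → Word → Word
run T []      st = st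
run T (a ∷ x) []       = if does (avoidsAll? T (a ∷ []))
                         then run T x (a ∷ []) else []
run T (a ∷ x) (t ∷ st) = if does (avoidsAll? T (a ∷ t ∷ st))
                         then run T x (a ∷ t ∷ st) else t ∷ run T (a ∷ x) st

s[_] : List Word → Word → Word
s[ T ] x = run T x []

West : Word → Word
West = s[ (2 ∷ 1 ∷ []) ∷ [] ]

Sort : ℕ → Word → Word → Pred Word 0ℓ
Sort n σ τ x = IsPerm n x × West (s[ σ ∷ τ ∷ [] ] x) ≡ identity n

HasCardinality : {A : Set} → Pred A 0ℓ → ℕ → Set
HasCardinality {A} P k = ∃ λ (L : List A) →
  Unique L × (∀ x → (x ∈ L) ⇔ P x) × length L ≡ k

{-# OPTIONS --safe #-}
module Submission where

-- The first entry b of x stays at the bottom of the stack to the end. Over the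
-- base b (or h b with h > b), entries below b undergo one pass of bubble sort:
-- the smallest one so far is held back and all others leave at once. West's
-- map sorts exactly the 231-avoiders; as the output ends in b and the least
-- entry leaves late, avoiding 231 forces that pass to give a decreasing word
-- and leaves room for at most one entry above b, in position two or three.
-- Hence, for n ≥ 4, x is n w, (n-1) n w or (n-1)(n-2) n w, where the bubble pass
-- makes w decreasing. Such w of length m arise by inserting the maximum into
-- the first or second place, so there are 2^(m-1), and
-- 2^(n-2) + 2^(n-3) + 2^(n-4) = 7 · 2^(n-4).

open import Data.Empty using (⊥; ⊥-elim)
open import Data.Fin using (Fin; zero; suc)
open import Data.List using (List; []; _∷_; _++_; length; map; upTo)
open import Data.List.Membership.Propositional using (_∈_)
open import Data.List.Membership.Propositional.Properties using (∈-map⁺; ∈-map⁻; ∈-++⁺ˡ; ∈-++⁺ʳ; ∈-++⁻)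
open import Data.List.Properties using (upTo-∷ʳ; map-++; ++-assoc; length-map; length-++; length-upTo; ∷-injectiveˡ; ∷-injectiveʳ)
open import Data.List.Relation.Binary.Disjoint.Propositional using (Disjoint)
open import Data.List.Relation.Binary.Permutation.Propositional using (_↭_; prep; swap; ↭-refl; ↭-sym; ↭-trans; ↭-reflexive; ↭⇒↭ₛ)
open import Data.List.Relation.Binary.Permutation.Propositional.Properties using (All-resp-↭; ∈-resp-↭; ↭-length; drop-∷; ∷↭∷ʳ)
import Data.List.Relation.Binary.Permutation.Setoid.Properties as Permutationₛ
open import Data.List.Relation.Binary.Sublist.Propositional using (_⊆_; []; _∷_; _∷ʳ_; ⊆-refl; ⊆-trans; minimum; from∈; to∈)
open import Data.List.Relation.Binary.Sublist.Propositional.Properties using (All-resp-⊆; length-mono-≤; ++⁺ʳ)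
open import Data.List.Relation.Unary.All as All using (All; []; _∷_)
open import Data.List.Relation.Unary.All.Properties using (¬Any⇒All¬)
open import Data.List.Relation.Unary.AllPairs as AllPairs using (AllPairs; []; _∷_)
import Data.List.Relation.Unary.AllPairs.Properties as AllPairs
open import Data.List.Relation.Unary.Any as Any using (Any; here; there)
open import Data.List.Relation.Unary.Unique.Propositional using (Unique)
import Data.List.Relation.Unary.Unique.Propositional.Properties as Unique
open import Data.Nat using (ℕ; zero; suc; _+_; _≤_; _<_; _>_; _<?_; _≥_; _*_; _^_; _∸_; s≤s; z≤n; s<s)
open import Data.Nat.Properties
open import Data.Nat.Tactic.RingSolver using (solve-∀)
open import Data.Product using (∃; ∃₂; _×_; _,_)
open import Data.Sum using (_⊎_; inj₁; inj₂)
open import Function using (_⇔_; mk⇔; Equivalence)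
open import Relation.Binary.Definitions using (tri<; tri≈; tri>)
open import Relation.Binary.PropositionalEquality using (_≡_; _≢_; refl; sym; trans; cong; cong₂; subst; ≢-sym; setoid)
open import Relation.Nullary using (¬_; yes; no; contradiction)
open import Defs

private
  variable
    a b c l h : ℕ
    w x y st r : Word
    T : List Word

-- Running an arbitrary pattern-avoiding stack

run-push : AvoidsAll T (a ∷ st) → run T (a ∷ x) st ≡ run T x (a ∷ st)
run-push {T} {a} {[]} av with avoidsAll? T (a ∷ [])
... | yes _  = refl
... | no ¬av = contradiction av ¬av
run-push {T} {a} {t ∷ st} av with avoidsAll? T (a ∷ t ∷ st)
... | yes _  = refl
... | no ¬av = contradiction av ¬av

run-pop : ∀ {t} → ¬ AvoidsAll T (a ∷ t ∷ st) → run T (a ∷ x) (t ∷ st) ≡ t ∷ run T (a ∷ x) st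
run-pop {T} {a} {st} {t = t} ¬av with avoidsAll? T (a ∷ t ∷ st)
... | yes av = contradiction av ¬av
... | no  _  = refl

-- Quantifying over all of `x` covers the empty input as well, where `p` also leaves next.
run-blocked : ∀ {p} → All (λ d → ¬ AvoidsAll T (d ∷ p ∷ st)) x → run T x (p ∷ st) ≡ p ∷ run T x st
run-blocked []        = refl
run-blocked (¬av ∷ _) = run-pop ¬av

-- Later entries only land on top, so stacked entries leave in their order from top to bottom.
-- Patterns can thus be found in the output without following the rest of the run.
stack⊆run : ∀ T x st → st ⊆ run T x st
stack⊆run T []      st = ⊆-refl
stack⊆run T (a ∷ x) [] = minimum _
stack⊆run T (a ∷ x) (t ∷ st) with avoidsAll? T (a ∷ t ∷ st) | stack⊆run T x (a ∷ t ∷ st) | stack⊆run T (a ∷ x) st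
... | yes _ | pushed | _      = ⊆-trans (a ∷ʳ ⊆-refl) pushed
... | no  _ | _      | popped = refl ∷ popped

-- West's map and the pattern 231

T₂₁ : List Word
T₂₁ = (2 ∷ 1 ∷ []) ∷ []

both : ∀ {A B : Set} → A → B → A ⇔ B
both p q = mk⇔ (λ _ → q) (λ _ → p)

neither : ∀ {A B : Set} → ¬ A → ¬ B → A ⇔ B
neither ¬p ¬q = mk⇔ (λ p → contradiction p ¬p) (λ q → contradiction q ¬q)

avoids₂₁⇒≮ : AvoidsAll T₂₁ st → a ∷ b ∷ [] ⊆ st → ¬ b < a
avoids₂₁⇒≮ {a = a} {b} (av ∷ []) s b<a = av (a ∷ b ∷ [] , s , refl , iso)
  where
  iso : ∀ (i j : Fin 2) → _
  iso zero       zero       = neither (<-irrefl refl) (<-irrefl refl)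
  iso zero       (suc zero) = neither (<-asym b<a) λ { (s≤s ()) }
  iso (suc zero) zero       = both b<a ≤-refl
  iso (suc zero) (suc zero) = neither (<-irrefl refl) (<-irrefl refl)

AllPairs-resp-⊆ : ∀ {R : ℕ → ℕ → Set} → y ⊆ x → AllPairs R x → AllPairs R y
AllPairs-resp-⊆ []         []       = []
AllPairs-resp-⊆ (_ ∷ʳ s)   (_ ∷ ps) = AllPairs-resp-⊆ s ps
AllPairs-resp-⊆ (refl ∷ s) (p ∷ ps) = All-resp-⊆ s p ∷ AllPairs-resp-⊆ s ps

increasing⇒avoids₂₁ : AllPairs _<_ st → AvoidsAll T₂₁ st
increasing⇒avoids₂₁ {st} inc = no21 ∷ []
  where
  no21 : Avoids st (2 ∷ 1 ∷ [])
  no21 (a ∷ b ∷ [] , s , refl , iso) with AllPairs-resp-⊆ s inc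
  ... | (a<b ∷ []) ∷ _ = <-asym a<b (Equivalence.from (iso (suc zero) zero) ≤-refl)

Avoids231 : Word → Set
Avoids231 x = ∀ {a b c} → b ∷ c ∷ a ∷ [] ⊆ x → a < b → b < c → ⊥

avoids231-⊆ : y ⊆ x → Avoids231 x → Avoids231 y
avoids231-⊆ y⊆x av s = av (⊆-trans s y⊆x)

-- `T` stays abstract, so that the containment test is not unfolded in the case splits. West's stack
-- enters only through two facts: single entries may be pushed, and accepted stacks have no descent.
module _ (T : List Word) (push₁ : ∀ a → AvoidsAll T (a ∷ [])) where

  input∈run : ∀ x st → a ∈ x → a ∈ run T x st
  input∈run (d ∷ x) [] p rewrite run-push {T = T} {x = x} (push₁ d) with p
  ... | here refl = to∈ (stack⊆run T x (d ∷ []))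
  ... | there p′  = input∈run x (d ∷ []) p′
  input∈run (d ∷ x) (t ∷ st) p with avoidsAll? T (d ∷ t ∷ st)
  input∈run (d ∷ x) (t ∷ st) (here refl) | yes _ = to∈ (⊆-trans (refl ∷ minimum _) (stack⊆run T x (d ∷ t ∷ st)))
  input∈run (d ∷ x) (t ∷ st) (there p)   | yes _ = input∈run x (d ∷ t ∷ st) p
  input∈run (d ∷ x) (t ∷ st) p           | no  _ = there (input∈run (d ∷ x) st p)

  module _ (increasing : ∀ {st a b} → AvoidsAll T st → a ∷ b ∷ [] ⊆ st → ¬ b < a) where

    -- The larger `c` cannot enter above `b`, so `b` is popped no later than when `c` is next in the
    -- input; `a` is then still unread and comes out afterwards.
    stack-before-input : ∀ x st → b ∈ st → c ∷ a ∷ [] ⊆ x → b < c → b ∷ a ∷ [] ⊆ run T x st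
    stack-before-input (d ∷ x) (t ∷ st) b∈st ca⊆x b<c with avoidsAll? T (d ∷ t ∷ st)
    stack-before-input (d ∷ x) (t ∷ st) b∈st (refl ∷ _) b<c | yes av =
      contradiction b<c (increasing av (refl ∷ from∈ b∈st))
    stack-before-input (d ∷ x) (t ∷ st) b∈st (_ ∷ʳ ca⊆x) b<c | yes _ =
      stack-before-input x (d ∷ t ∷ st) (there b∈st) ca⊆x b<c
    stack-before-input (d ∷ x) (t ∷ st) (here refl) ca⊆x b<c | no _ =
      refl ∷ from∈ (input∈run (d ∷ x) st (to∈ (⊆-trans (_ ∷ʳ ⊆-refl) ca⊆x)))
    stack-before-input (d ∷ x) (t ∷ st) (there b∈st) ca⊆x b<c | no _ =
      t ∷ʳ stack-before-input (d ∷ x) st b∈st ca⊆x b<c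

    -- If b < c and b precedes c, then b must leave the stack before c can
    -- enter it, so b also leaves before any entry read after c.
    ascent-splits : ∀ x st → b ∷ c ∷ a ∷ [] ⊆ x → b < c → b ∷ a ∷ [] ⊆ run T x st
    ascent-splits (d ∷ x) [] s b<c rewrite run-push {T = T} {x = x} (push₁ d) with s
    ... | refl ∷ s′ = stack-before-input x (d ∷ []) (here refl) s′ b<c
    ... | _ ∷ʳ s′   = ascent-splits x (d ∷ []) s′ b<c
    ascent-splits (d ∷ x) (t ∷ st) s b<c with avoidsAll? T (d ∷ t ∷ st)
    ascent-splits (d ∷ x) (t ∷ st) (refl ∷ s) b<c | yes _ = stack-before-input x (d ∷ t ∷ st) (here refl) s b<c
    ascent-splits (d ∷ x) (t ∷ st) (_ ∷ʳ s)   b<c | yes _ = ascent-splits x (d ∷ t ∷ st) s b<c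
    ascent-splits (d ∷ x) (t ∷ st) s          b<c | no  _ = t ∷ʳ ascent-splits (d ∷ x) st s b<c

identity-increasing : ∀ n → AllPairs _<_ (identity n)
identity-increasing n = AllPairs.map⁺ (AllPairs.applyUpTo⁺₁ _ n (λ i<j _ → s<s i<j))

west-sorted⇒avoids231 : ∀ {n} x → West x ≡ identity n → Avoids231 x
west-sorted⇒avoids231 {n} x eq bca⊆x a<b b<c
  with AllPairs-resp-⊆ ba⊆id (identity-increasing n)
  where
  ba⊆id = subst (_ ⊆_) eq (ascent-splits T₂₁ (λ _ → increasing⇒avoids₂₁ ([] ∷ [])) avoids₂₁⇒≮ x [] bca⊆x b<c)
... | (b<a ∷ []) ∷ _ = <-asym a<b b<a

-- The stack avoiding 123 and 321

T₃ : List Word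
T₃ = (1 ∷ 2 ∷ 3 ∷ []) ∷ (3 ∷ 2 ∷ 1 ∷ []) ∷ []

-- Opaque, since run T₃ would unfold the decision procedure for pattern containment.
opaque
  run₃ : Word → Word → Word
  run₃ = run T₃

  run₃-def : run₃ x st ≡ run T₃ x st
  run₃-def = refl

  run₃-[] : run₃ [] st ≡ st
  run₃-[] = refl

  run₃-push : AvoidsAll T₃ (a ∷ st) → run₃ (a ∷ x) st ≡ run₃ x (a ∷ st)
  run₃-push = run-push

  run₃-pop : ∀ {t} → ¬ AvoidsAll T₃ (a ∷ t ∷ st) → run₃ (a ∷ x) (t ∷ st) ≡ t ∷ run₃ (a ∷ x) st
  run₃-pop = run-pop

  run₃-blocked : ∀ {p} → All (λ d → ¬ AvoidsAll T₃ (d ∷ p ∷ st)) x → run₃ x (p ∷ st) ≡ p ∷ run₃ x st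
  run₃-blocked = run-blocked

  stack⊆run₃ : ∀ x st → st ⊆ run₃ x st
  stack⊆run₃ = stack⊆run T₃

Monotone : ℕ → ℕ → ℕ → Set
Monotone a b c = (a < b × b < c) ⊎ (b < a × c < b)

monotone-free⇒avoids : (∀ {a b c} → a ∷ b ∷ c ∷ [] ⊆ st → ¬ Monotone a b c) → AvoidsAll T₃ st
monotone-free⇒avoids {st} free = no123 ∷ no321 ∷ []
  where
  no123 : Avoids st (1 ∷ 2 ∷ 3 ∷ [])
  no123 (_ ∷ _ ∷ _ ∷ [] , s , refl , iso) =
    free s (inj₁ (Equivalence.from (iso zero (suc zero)) ≤-refl , Equivalence.from (iso (suc zero) (suc (suc zero))) ≤-refl))
  no321 : Avoids st (3 ∷ 2 ∷ 1 ∷ [])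
  no321 (_ ∷ _ ∷ _ ∷ [] , s , refl , iso) =
    free s (inj₂ (Equivalence.from (iso (suc zero) zero) ≤-refl , Equivalence.from (iso (suc (suc zero)) (suc zero)) ≤-refl))

monotone⇒¬avoids : a ∷ b ∷ c ∷ [] ⊆ st → Monotone a b c → ¬ AvoidsAll T₃ st
monotone⇒¬avoids {a} {b} {c} s (inj₁ (a<b , b<c)) (av ∷ _ ∷ []) = av (_ , s , refl , iso)
  where
  a<c = <-trans a<b b<c
  iso : ∀ (i j : Fin 3) → _
  iso zero             zero             = neither (<-irrefl refl) (<-irrefl refl)
  iso zero             (suc zero)       = both a<b ≤-refl
  iso zero             (suc (suc zero)) = both a<c (s≤s (s≤s z≤n))
  iso (suc zero)       zero             = neither (<-asym a<b) λ { (s≤s ()) }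
  iso (suc zero)       (suc zero)       = neither (<-irrefl refl) (<-irrefl refl)
  iso (suc zero)       (suc (suc zero)) = both b<c ≤-refl
  iso (suc (suc zero)) zero             = neither (<-asym a<c) λ { (s≤s ()) }
  iso (suc (suc zero)) (suc zero)       = neither (<-asym b<c) λ { (s≤s (s≤s ())) }
  iso (suc (suc zero)) (suc (suc zero)) = neither (<-irrefl refl) (<-irrefl refl)
monotone⇒¬avoids {a} {b} {c} s (inj₂ (b<a , c<b)) (_ ∷ av ∷ []) = av (_ , s , refl , iso)
  where
  c<a = <-trans c<b b<a
  iso : ∀ (i j : Fin 3) → _
  iso zero             zero             = neither (<-irrefl refl) (<-irrefl refl)
  iso zero             (suc zero)       = neither (<-asym b<a) λ { (s≤s (s≤s ())) }
  iso zero             (suc (suc zero)) = neither (<-asym c<a) λ { (s≤s ()) }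
  iso (suc zero)       zero             = both b<a ≤-refl
  iso (suc zero)       (suc zero)       = neither (<-irrefl refl) (<-irrefl refl)
  iso (suc zero)       (suc (suc zero)) = neither (<-asym c<b) λ { (s≤s ()) }
  iso (suc (suc zero)) zero             = both c<a (s≤s (s≤s z≤n))
  iso (suc (suc zero)) (suc zero)       = both c<b ≤-refl
  iso (suc (suc zero)) (suc (suc zero)) = neither (<-irrefl refl) (<-irrefl refl)

short : length y < length x → ¬ x ⊆ y
short y<x x⊆y = <⇒≱ y<x (length-mono-≤ x⊆y)

avoids₁ : ∀ a → AvoidsAll T₃ (a ∷ [])
avoids₁ a = monotone-free⇒avoids λ s → contradiction s (short (s≤s (s≤s z≤n)))

avoids₂ : ∀ a b → AvoidsAll T₃ (a ∷ b ∷ [])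
avoids₂ a b = monotone-free⇒avoids λ s → contradiction s (short ≤-refl)

avoids₃ : ¬ Monotone a b c → AvoidsAll T₃ (a ∷ b ∷ c ∷ [])
avoids₃ {a} {b} {c} ¬m = monotone-free⇒avoids free
  where
  free : ∀ {i j k} → i ∷ j ∷ k ∷ [] ⊆ a ∷ b ∷ c ∷ [] → ¬ Monotone i j k
  free (refl ∷ refl ∷ refl ∷ []) = ¬m
  free (refl ∷ refl ∷ _ ∷ʳ ())
  free (refl ∷ _ ∷ʳ s) = contradiction s (short ≤-refl)
  free (_ ∷ʳ s)        = contradiction s (short ≤-refl)

-- Four entries are the tallest stack whose admissibility ever has to be shown: two entries over a
-- base of two.
avoids₄ : ∀ {d} → ¬ Monotone a b c → ¬ Monotone a b d → ¬ Monotone a c d → ¬ Monotone b c d → AvoidsAll T₃ (a ∷ b ∷ c ∷ d ∷ [])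
avoids₄ {a} {b} {c} {d} abc abd acd bcd = monotone-free⇒avoids free
  where
  free : ∀ {i j k} → i ∷ j ∷ k ∷ [] ⊆ a ∷ b ∷ c ∷ d ∷ [] → ¬ Monotone i j k
  free (refl ∷ refl ∷ refl ∷ _)          = abc
  free (refl ∷ refl ∷ _ ∷ʳ refl ∷ _)     = abd
  free (refl ∷ refl ∷ _ ∷ʳ _ ∷ʳ ())
  free (refl ∷ _ ∷ʳ refl ∷ refl ∷ _)     = acd
  free (refl ∷ _ ∷ʳ refl ∷ _ ∷ʳ ())
  free (refl ∷ _ ∷ʳ _ ∷ʳ s)              = contradiction s (short ≤-refl)
  free (_ ∷ʳ refl ∷ refl ∷ refl ∷ _)     = bcd
  free (_ ∷ʳ refl ∷ refl ∷ _ ∷ʳ ())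
  free (_ ∷ʳ refl ∷ _ ∷ʳ s)              = contradiction s (short ≤-refl)
  free (_ ∷ʳ _ ∷ʳ s)                     = contradiction s (short ≤-refl)

valley : b < a → b < c → ¬ Monotone a b c
valley b<a b<c (inj₁ (a<b , _)) = <-asym a<b b<a
valley b<a b<c (inj₂ (_ , c<b)) = <-asym b<c c<b

peak : a < b → c < b → ¬ Monotone a b c
peak a<b c<b (inj₁ (_ , b<c)) = <-asym b<c c<b
peak a<b c<b (inj₂ (b<a , _)) = <-asym a<b b<a

-- Bubble sort over the bottom of the stack

-- Entries below `b` behave alike over both bottoms: with such an entry on top, `h` and `b` form a
-- peak, which is never monotone.
data Base (b : ℕ) : Word → Set where
  alone : Base b (b ∷ [])
  under : b < h → Base b (h ∷ b ∷ [])

base∋ : Base b r → b ∈ r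
base∋ alone     = here refl
base∋ (under _) = there (here refl)

base-avoids₁ : Base b r → l < b → AvoidsAll T₃ (l ∷ r)
base-avoids₁ alone       l<b = avoids₂ _ _
base-avoids₁ (under b<h) l<b = avoids₃ (peak (<-trans l<b b<h) b<h)

base-avoids₂ : Base b r → l < b → c < b → l < c → AvoidsAll T₃ (c ∷ l ∷ r)
base-avoids₂ alone       l<b c<b l<c = avoids₃ (valley l<c l<b)
base-avoids₂ (under b<h) l<b c<b l<c = avoids₄ (valley l<c (<-trans l<b b<h)) (valley l<c l<b)
  (peak (<-trans c<b b<h) b<h) (peak (<-trans l<b b<h) b<h)

-- Once `c` sits on `l`, any next entry `d` is refused: `d < c < b` would be a 123 and `d > c > l` a
-- 321. So `c` leaves at once and `l` remains.
step-up : Base b r → l < b → c < b → l < c → All (c ≢_) w → run₃ (c ∷ w) (l ∷ r) ≡ c ∷ run₃ w (l ∷ r)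
step-up {b} {r} {l} {c} base l<b c<b l<c c∉w =
  trans (run₃-push (base-avoids₂ base l<b c<b l<c)) (run₃-blocked (All.map blocks c∉w))
  where
  blocks : ∀ {d} → c ≢ d → ¬ AvoidsAll T₃ (d ∷ c ∷ l ∷ r)
  blocks {d} c≢d with <-cmp d c
  ... | tri< d<c _ _ = monotone⇒¬avoids (refl ∷ refl ∷ _ ∷ʳ from∈ (base∋ base)) (inj₁ (d<c , c<b))
  ... | tri≈ _ d≡c _ = contradiction (sym d≡c) c≢d
  ... | tri> _ _ c<d = monotone⇒¬avoids (refl ∷ refl ∷ refl ∷ minimum _) (inj₂ (c<d , l<c))

-- Pushing `c` would create the 123 `c < l < b`, so `l` leaves and `c` takes its place.
step-down : Base b r → l < b → c < l → run₃ (c ∷ w) (l ∷ r) ≡ l ∷ run₃ w (c ∷ r)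
step-down base l<b c<l =
  trans (run₃-pop (monotone⇒¬avoids (refl ∷ refl ∷ from∈ (base∋ base)) (inj₁ (c<l , l<b))))
        (cong (_ ∷_) (run₃-push (base-avoids₁ base (<-trans c<l l<b))))

-- One pass of bubble sort, carrying the smallest entry seen to the end.
bubble : ℕ → Word → Word
bubble l []      = l ∷ []
bubble l (c ∷ w) with l <? c
... | yes _ = c ∷ bubble l w
... | no  _ = l ∷ bubble c w

bubble-↭ : ∀ l w → bubble l w ↭ l ∷ w
bubble-↭ l []      = ↭-refl
bubble-↭ l (c ∷ w) with l <? c
... | yes _ = ↭-trans (prep c (bubble-↭ l w)) (swap c l ↭-refl)
... | no  _ = prep l (bubble-↭ c w)

-- `step-up` and `step-down` are the two branches of `bubble`; distinctness makes the second
-- comparison strict.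
run₃≡bubble : Base b r → ∀ l w → l < b → All (_< b) w → Unique (l ∷ w) → run₃ w (l ∷ r) ≡ bubble l w ++ r
run₃≡bubble base l []      l<b []          _ = run₃-[]
run₃≡bubble base l (c ∷ w) l<b (c<b ∷ w<b) ((l≢c ∷ l∉w) ∷ c∉w ∷ w!) with l <? c
... | yes l<c = trans (step-up base l<b c<b l<c c∉w) (cong (c ∷_) (run₃≡bubble base l w l<b w<b (l∉w ∷ w!)))
... | no  l≮c = trans (step-down base l<b (≤∧≢⇒< (≮⇒≥ l≮c) (≢-sym l≢c))) (cong (l ∷_) (run₃≡bubble base c w c<b w<b (c∉w ∷ w!)))

bubble-small : ∀ l w → ∃ λ m → m ≤ l × m ∈ bubble l w
bubble-small l []      = l , ≤-refl , here refl
bubble-small l (c ∷ w) with l <? c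
... | no  _ = l , ≤-refl , here refl
... | yes _ with m , m≤l , m∈ ← bubble-small l w = m , m≤l , there m∈

-- An entry above the held one leaves before it, and the held entry is only ever replaced by a
-- smaller one. This supplies the final 1 of a 231.
bubble-drops : ∀ l w {e} → e ∈ bubble l w → l < e → ∃ λ m → m ≤ l × e ∷ m ∷ [] ⊆ bubble l w
bubble-drops l [] (here refl) l<l = contradiction l<l (<-irrefl refl)
bubble-drops l (c ∷ w) e∈ l<e with l <? c
bubble-drops l (c ∷ w) (here refl) l<e | yes _ with m , m≤l , m∈ ← bubble-small l w = m , m≤l , refl ∷ from∈ m∈
bubble-drops l (c ∷ w) (there e∈)  l<e | yes _ with m , m≤l , s ← bubble-drops l w e∈ l<e = m , m≤l , _ ∷ʳ s
bubble-drops l (c ∷ w) (here refl) l<l | no  _ = contradiction l<l (<-irrefl refl)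
bubble-drops l (c ∷ w) (there e∈)  l<e | no l≮c with m , m≤c , s ← bubble-drops c w e∈ (≤-<-trans (≮⇒≥ l≮c) l<e) =
  m , ≤-trans m≤c (≮⇒≥ l≮c) , _ ∷ʳ s

-- An output entry `e` above `o` would be followed by some `m ≤ l < o`, making `o e m` a 231.
bubble-dominated : ∀ {o} l w → l < o → All (o ≢_) w → Avoids231 (o ∷ bubble l w) → All (o >_) (bubble l w)
bubble-dominated {o} l w l<o o∉w av = All.tabulate below
  where
  below : ∀ {e} → e ∈ bubble l w → e < o
  below {e} e∈ with <-cmp e o
  ... | tri< e<o _ _ = e<o
  ... | tri≈ _ refl _ = contradiction refl (All.lookup (All-resp-↭ (↭-sym (bubble-↭ l w)) (≢-sym (<⇒≢ l<o) ∷ o∉w)) e∈)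
  ... | tri> _ _ o<e with m , m≤l , s ← bubble-drops l w e∈ (<-trans l<o o<e) =
    ⊥-elim (av (refl ∷ s) (≤-<-trans m≤l l<o) o<e)

-- Each entry put out exceeds the one still held, so it dominates all later output by
-- `bubble-dominated`.
bubble-decreasing : ∀ l w → Unique (l ∷ w) → Avoids231 (bubble l w) → AllPairs _>_ (bubble l w)
bubble-decreasing l []      _ _ = [] ∷ []
bubble-decreasing l (c ∷ w) ((l≢c ∷ l∉w) ∷ c∉w ∷ w!) av with l <? c
... | yes l<c = bubble-dominated l w l<c c∉w av ∷ bubble-decreasing l w (l∉w ∷ w!) (avoids231-⊆ (_ ∷ʳ ⊆-refl) av)
... | no  l≮c = bubble-dominated c w (≤∧≢⇒< (≮⇒≥ l≮c) (≢-sym l≢c)) l∉w av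
              ∷ bubble-decreasing c w (c∉w ∷ w!) (avoids231-⊆ (_ ∷ʳ ⊆-refl) av)

-- Sortable words, with b the first entry, which stays at the bottom of the stack

-- Until an entry above `b` is read, a low entry `m ≤ l` is held over `b`. The first high entry `h`
-- forms a valley with `m` and `b`, is pushed onto `m`, and so leaves before it.
high-above-low : ∀ l w → l < b → Unique (l ∷ w) → All (b ≢_) w → Any (b <_) w →
                 ∃₂ λ h m → b < h × m ≤ l × h ∷ m ∷ [] ⊆ run₃ w (l ∷ b ∷ [])
high-above-low {b} l (c ∷ w) l<b ((l≢c ∷ l∉w) ∷ c∉w ∷ w!) (b≢c ∷ b∉w) high with <-cmp c b
... | tri≈ _ c≡b _ = contradiction (sym c≡b) b≢c
... | tri> _ _ b<c = c , l , b<c , ≤-refl ,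
  subst (_ ⊆_) (sym (run₃-push (avoids₃ (valley (<-trans l<b b<c) l<b))))
    (⊆-trans (refl ∷ refl ∷ minimum _) (stack⊆run₃ w (c ∷ l ∷ b ∷ [])))
... | tri< c<b _ b≮c with Any.tail b≮c high | <-cmp l c
... | high′ | tri≈ _ l≡c _ = contradiction l≡c l≢c
... | high′ | tri< l<c _ _ with h , m , b<h , m≤l , s ← high-above-low l w l<b (l∉w ∷ w!) b∉w high′ =
  h , m , b<h , m≤l , subst (_ ⊆_) (sym (step-up alone l<b c<b l<c c∉w)) (_ ∷ʳ s)
... | high′ | tri> _ _ c<l with h , m , b<h , m≤c , s ← high-above-low c w c<b (c∉w ∷ w!) b∉w high′ =
  h , m , b<h , ≤-trans m≤c (<⇒≤ c<l) , subst (_ ⊆_) (sym (step-down alone l<b c<l)) (_ ∷ʳ s)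

-- A later entry `c` above `b` yields a 231 ending in `b`: `c h b` if `c < h`, since `c` is stacked
-- above both, and `h c b` if `h < c`, since `l` and `h` must leave before `c` enters.
under-high⇒low : ∀ l w → l < b → b < h → Unique (l ∷ w) → All (b ≢_) w → All (h ≢_) w →
                 Avoids231 (run₃ w (l ∷ h ∷ b ∷ [])) → All (_< b) w
under-high⇒low l [] _ _ _ _ _ _ = []
under-high⇒low {b} {h} l (c ∷ w) l<b b<h ((l≢c ∷ l∉w) ∷ c∉w ∷ w!) (b≢c ∷ b∉w) (h≢c ∷ h∉w) av with <-cmp c b
... | tri≈ _ c≡b _ = contradiction (sym c≡b) b≢c
... | tri< c<b _ _ with <-cmp l c
...   | tri≈ _ l≡c _ = contradiction l≡c l≢c
...   | tri< l<c _ _ = c<b ∷ under-high⇒low l w l<b b<h (l∉w ∷ w!) b∉w h∉w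
  (avoids231-⊆ (_ ∷ʳ ⊆-refl) (subst Avoids231 (step-up (under b<h) l<b c<b l<c c∉w) av))
...   | tri> _ _ c<l = c<b ∷ under-high⇒low c w c<b b<h (c∉w ∷ w!) b∉w h∉w
  (avoids231-⊆ (_ ∷ʳ ⊆-refl) (subst Avoids231 (step-down (under b<h) l<b c<l) av))
under-high⇒low {b} {h} l (c ∷ w) l<b b<h _ _ (h≢c ∷ _) av | tri> _ _ b<c with <-cmp c h
... | tri≈ _ c≡h _ = contradiction (sym c≡h) h≢c
... | tri< c<h _ _ = ⊥-elim (subst Avoids231 pushed av
    (⊆-trans (refl ∷ _ ∷ʳ ⊆-refl) (stack⊆run₃ w (c ∷ l ∷ h ∷ b ∷ []))) b<c c<h)
  where
  l<h = <-trans l<b b<h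
  pushed = run₃-push {x = w} (avoids₄ (valley (<-trans l<b b<c) l<h) (valley (<-trans l<b b<c) l<b) (peak c<h b<h) (peak l<h b<h))
... | tri> _ _ h<c = ⊥-elim (subst Avoids231 popped av
    (_ ∷ʳ refl ∷ stack⊆run₃ w (c ∷ b ∷ [])) b<h h<c)
  where
  popped : run₃ (c ∷ w) (l ∷ h ∷ b ∷ []) ≡ l ∷ h ∷ run₃ w (c ∷ b ∷ [])
  popped = trans (run₃-pop (monotone⇒¬avoids (refl ∷ _ ∷ʳ ⊆-refl) (inj₂ (h<c , b<h))))
    (cong (l ∷_) (trans (run₃-pop (monotone⇒¬avoids ⊆-refl (inj₂ (h<c , b<h)))) (cong (h ∷_) (run₃-push (avoids₂ c b)))))

-- The high entry `h` is pushed onto `l`, but `c < l < b` then forces both `h` and `l` out before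
-- `c` enters.
step-over : l < b → b < h → c < l → run₃ (h ∷ c ∷ w) (l ∷ b ∷ []) ≡ h ∷ l ∷ run₃ w (c ∷ b ∷ [])
step-over l<b b<h c<l = trans (run₃-push (avoids₃ (valley (<-trans l<b b<h) l<b)))
  (trans (run₃-pop (monotone⇒¬avoids (refl ∷ _ ∷ʳ ⊆-refl) (inj₁ (c<l , l<b)))) (cong (_ ∷_) (step-down alone l<b c<l)))

-- In each case the decreasing word is a rearrangement of the index, so for a permutation it is the
-- decreasing permutation, which fixes the values of `b`, `h` and, in `shape₃`, `l`.
data Shape : Word → Set where
  shape₁ : AllPairs _>_ (b ∷ bubble l w) → Shape (b ∷ l ∷ w)
  shape₂ : AllPairs _>_ (h ∷ b ∷ bubble l w) → Shape (b ∷ h ∷ l ∷ w)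
  shape₃ : AllPairs _>_ (h ∷ b ∷ l ∷ bubble c w) → Shape (b ∷ l ∷ h ∷ c ∷ w)

no-high⇒low : All (b ≢_) w → ¬ Any (b <_) w → All (_< b) w
no-high⇒low b∉w no-high = All.zipWith (λ (b≢d , b≮d) → ≤∧≢⇒< (≮⇒≥ b≮d) (≢-sym b≢d)) (b∉w , ¬Any⇒All¬ _ no-high)

bubble-All : ∀ {P : ℕ → Set} l w → All P (l ∷ w) → All P (bubble l w)
bubble-All l w = All-resp-↭ (↭-sym (bubble-↭ l w))

bubble-decreasing′ : ∀ l w → Unique (l ∷ w) → bubble l w ++ r ⊆ y → Avoids231 y → AllPairs _>_ (bubble l w)
bubble-decreasing′ {r} l w w! s av = bubble-decreasing l w w! (avoids231-⊆ (⊆-trans (++⁺ʳ r ⊆-refl) s) av)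

-- Without entries above `b` the whole run is a bubble pass. Otherwise 231-avoidance forces the high
-- entry into third place, a fourth entry below `l`, and no further high entry.
shape-low-second : ∀ b l w → l < b → Unique (b ∷ l ∷ w) → length w ≥ 2 → Avoids231 (run₃ w (l ∷ b ∷ [])) → Shape (b ∷ l ∷ w)
shape-low-second b l w l<b ((_ ∷ b∉w) ∷ w!) len av with Any.any? (b <?_) w
shape-low-second b l w l<b ((_ ∷ b∉w) ∷ w!) len av | no no-high =
  shape₁ (bubble-All l w (l<b ∷ w<b) ∷ bubble-decreasing′ l w w! ⊆-refl (subst Avoids231 (run₃≡bubble alone l w l<b w<b w!) av))
  where
  w<b = no-high⇒low b∉w no-high
shape-low-second b l (c ∷ w) l<b ((_ ∷ b≢c ∷ b∉w) ∷ (l≢c ∷ l∉w) ∷ c∉w ∷ w!) len av | yes high with <-cmp c b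
... | tri≈ _ c≡b _ = contradiction (sym c≡b) b≢c
... | tri< c<b _ b≮c with Any.tail b≮c high | <-cmp l c
...   | high′ | tri≈ _ l≡c _ = contradiction l≡c l≢c
-- If the third entry is low, it or `l` leaves at once, and a later high `h` followed by a still
-- smaller `m` completes a 231.
...   | high′ | tri< l<c _ _ with h , m , b<h , m≤l , s ← high-above-low l w l<b (l∉w ∷ w!) b∉w high′ =
  ⊥-elim (subst Avoids231 (step-up alone l<b c<b l<c c∉w) av (refl ∷ s) (≤-<-trans m≤l l<c) (<-trans c<b b<h))
...   | high′ | tri> _ _ c<l with h , m , b<h , m≤c , s ← high-above-low c w c<b (c∉w ∷ w!) b∉w high′ =
  ⊥-elim (subst Avoids231 (step-down alone l<b c<l) av (refl ∷ s) (≤-<-trans m≤c c<l) (<-trans l<b b<h))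
shape-low-second b l (h ∷ d ∷ w) l<b ((_ ∷ b≢h ∷ b≢d ∷ b∉w) ∷ (l≢h ∷ l≢d ∷ l∉w) ∷ (h≢d ∷ h∉w) ∷ d∉w ∷ w!) len av | yes _ | tri> _ _ b<h = go
  where
  l<h = <-trans l<b b<h
  start : run₃ (h ∷ d ∷ w) (l ∷ b ∷ []) ≡ run₃ (d ∷ w) (h ∷ l ∷ b ∷ [])
  start = run₃-push (avoids₃ (valley l<h l<b))
  go : Shape (b ∷ l ∷ h ∷ d ∷ w)
  go with <-cmp d h | <-cmp l d
  ... | tri≈ _ d≡h _ | _            = contradiction (sym d≡h) h≢d
  ... | _            | tri≈ _ l≡d _ = contradiction l≡d l≢d
  -- The output contains the 231 `h d l`.
  ... | tri> _ _ h<d | _            = ⊥-elim (subst Avoids231 (trans start popped) av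
      (refl ∷ ⊆-trans (refl ∷ refl ∷ minimum _) (stack⊆run₃ w (d ∷ l ∷ b ∷ []))) l<h h<d)
    where
    popped : run₃ (d ∷ w) (h ∷ l ∷ b ∷ []) ≡ h ∷ run₃ w (d ∷ l ∷ b ∷ [])
    popped = trans (run₃-pop (monotone⇒¬avoids (refl ∷ refl ∷ refl ∷ minimum _) (inj₂ (h<d , l<h))))
      (cong (h ∷_) (run₃-push (avoids₃ (valley (<-trans l<h h<d) l<b))))
  -- All four entries are stacked, and `d h l` is a 231.
  ... | tri< d<h _ _ | tri< l<d _ _ = ⊥-elim (subst Avoids231 (trans start pushed) av
      (⊆-trans (refl ∷ refl ∷ refl ∷ minimum _) (stack⊆run₃ w (d ∷ h ∷ l ∷ b ∷ []))) l<d d<h)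
    where
    pushed = run₃-push {x = w} (avoids₄ (peak d<h l<h) (peak d<h b<h) (valley l<d l<b) (valley l<h l<b))
  ... | tri< d<h _ _ | tri> _ _ d<l = third (Any.any? (b <?_) w)
    where
    d<b = <-trans d<l l<b
    av′ : Avoids231 (h ∷ l ∷ run₃ w (d ∷ b ∷ []))
    av′ = subst Avoids231 (step-over l<b b<h d<l) av
    third : _ → Shape (b ∷ l ∷ h ∷ d ∷ w)
    -- A second high entry `h′` gives the 231 `l h′ m`.
    third (yes high) with h′ , m , b<h′ , m≤d , s ← high-above-low d w d<b (d∉w ∷ w!) b∉w high =
      ⊥-elim (av′ (_ ∷ʳ refl ∷ s) (≤-<-trans m≤d d<l) (<-trans l<b b<h′))
    third (no no-high) = shape₃
      ( (b<h ∷ l<h ∷ bubble-All d w (All.map (λ e<b → <-trans e<b b<h) (d<b ∷ w<b)))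
      ∷ (l<b ∷ bubble-All d w (d<b ∷ w<b))
      ∷ bubble-dominated d w d<l l∉w (avoids231-⊆ (_ ∷ʳ refl ∷ ++⁺ʳ (b ∷ []) ⊆-refl) av″)
      ∷ bubble-decreasing′ d w (d∉w ∷ w!) (_ ∷ʳ _ ∷ʳ ⊆-refl) av″)
      where
      w<b = no-high⇒low b∉w no-high
      av″ : Avoids231 (h ∷ l ∷ bubble d w ++ b ∷ [])
      av″ = subst (λ z → Avoids231 (h ∷ l ∷ z)) (run₃≡bubble alone d w d<b w<b (d∉w ∷ w!)) av′
-- The length bound matters here: `b l h` has output `h l b`, which avoids 231, yet it fits no
-- shape.
shape-low-second b l (h ∷ []) l<b _ (s≤s ()) av | yes _ | tri> _ _ b<h

-- The third entry `c` must lie below `b`: `c > h` expels `h` and gives the 231 `h c b`, while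
-- `b < c < h` stacks up the 231 `c h b`. Then `h b` is a base for the bubble pass.
shape-high-second : ∀ b h w → b < h → Unique (b ∷ h ∷ w) → length w ≥ 2 → Avoids231 (run₃ w (h ∷ b ∷ [])) → Shape (b ∷ h ∷ w)
shape-high-second b h (c ∷ w) b<h ((_ ∷ b≢c ∷ b∉w) ∷ (h≢c ∷ h∉w) ∷ c∉w ∷ w!) len av with <-cmp c h
... | tri≈ _ c≡h _ = contradiction (sym c≡h) h≢c
... | tri> _ _ h<c = ⊥-elim (subst Avoids231 popped av (refl ∷ stack⊆run₃ w (c ∷ b ∷ [])) b<h h<c)
  where
  popped : run₃ (c ∷ w) (h ∷ b ∷ []) ≡ h ∷ run₃ w (c ∷ b ∷ [])
  popped = trans (run₃-pop (monotone⇒¬avoids ⊆-refl (inj₂ (h<c , b<h)))) (cong (h ∷_) (run₃-push (avoids₂ c b)))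
... | tri< c<h _ _ = go (subst Avoids231 (run₃-push (avoids₃ (peak c<h b<h))) av)
  where
  go : Avoids231 (run₃ w (c ∷ h ∷ b ∷ [])) → Shape (b ∷ h ∷ c ∷ w)
  go av′ with <-cmp c b
  ... | tri≈ _ c≡b _ = contradiction (sym c≡b) b≢c
  ... | tri> _ _ b<c = ⊥-elim (av′ (stack⊆run₃ w (c ∷ h ∷ b ∷ [])) b<c c<h)
  ... | tri< c<b _ _ = shape₂
      ( (b<h ∷ bubble-All c w (All.map (λ e<b → <-trans e<b b<h) (c<b ∷ w<b)))
      ∷ bubble-All c w (c<b ∷ w<b)
      ∷ bubble-decreasing′ c w (c∉w ∷ w!) ⊆-refl (subst Avoids231 (run₃≡bubble (under b<h) c w c<b w<b (c∉w ∷ w!)) av′))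
    where
    w<b = under-high⇒low c w c<b b<h (c∉w ∷ w!) b∉w h∉w av′

sortable⇒shape : ∀ x → Unique x → length x ≥ 4 → Avoids231 (run₃ x []) → Shape x
sortable⇒shape (b ∷ e ∷ w) x!@((b≢e ∷ _) ∷ _) (s≤s (s≤s len)) av
  with <-cmp e b | subst Avoids231 (trans (run₃-push (avoids₁ b)) (run₃-push (avoids₂ e b))) av
... | tri< e<b _ _ | av′ = shape-low-second b e w e<b x! len av′
... | tri≈ _ e≡b _ | _   = contradiction (sym e≡b) b≢e
... | tri> _ _ b<e | av′ = shape-high-second b e w b<e x! len av′

-- Words which one bubble pass sorts into decreasing order

desc : ℕ → Word
desc zero    = []
desc (suc n) = suc n ∷ desc n

identity-∷ʳ : ∀ n → identity (suc n) ≡ identity n ++ suc n ∷ []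
identity-∷ʳ n = trans (cong (map suc) (sym (upTo-∷ʳ n))) (map-++ suc (upTo n) (n ∷ []))

desc↭identity : ∀ n → desc n ↭ identity n
desc↭identity zero    = ↭-refl
desc↭identity (suc n) = ↭-trans (prep _ (desc↭identity n))
  (↭-trans (∷↭∷ʳ (suc n) (identity n)) (↭-reflexive (sym (identity-∷ʳ n))))

desc≤ : ∀ n → All (_≤ n) (desc n)
desc≤ zero    = []
desc≤ (suc n) = ≤-refl ∷ All.map m≤n⇒m≤1+n (desc≤ n)

decreasing↭desc : ∀ n x → AllPairs _>_ x → x ↭ desc n → x ≡ desc n
decreasing↭desc zero    []      _ _ = refl
decreasing↭desc zero    (_ ∷ _) _ p with () ← ↭-length p
decreasing↭desc (suc n) []      _ p with () ← ↭-length p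
decreasing↭desc (suc n) (a ∷ x) (a> ∷ x>) p with ∈-resp-↭ (↭-sym p) (here refl)
... | here refl = cong (suc n ∷_) (decreasing↭desc n x x> (drop-∷ p))
... | there n∈x = contradiction (All.lookup a> n∈x) (≤⇒≯ (All.lookup (desc≤ (suc n)) (∈-resp-↭ p (here refl))))

insert₂ : ℕ → Word → Word
insert₂ m []      = m ∷ []
insert₂ m (a ∷ w) = a ∷ m ∷ w

insert₂-injective : ∀ {m} → insert₂ m x ≡ insert₂ m y → x ≡ y
insert₂-injective {[]}    {[]}    _    = refl
insert₂-injective {_ ∷ _} {_ ∷ _} refl = refl

-- The permutations of length k + 1 in which at most one smaller entry precedes
-- each entry.
bubblings : ℕ → List Word
bubblings zero    = (1 ∷ []) ∷ []
bubblings (suc k) = map (2 + k ∷_) (bubblings k) ++ map (insert₂ (2 + k)) (bubblings k)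

data Bubbles (k : ℕ) : Word → Set where
  bubbles : bubble l w ≡ desc (suc k) → Bubbles k (l ∷ w)

bubbles-↭ : ∀ {k} → Bubbles k w → w ↭ desc (suc k)
bubbles-↭ (bubbles {l} {w} eq) = ↭-trans (↭-sym (bubble-↭ l w)) (↭-reflexive eq)

bubbles-< : ∀ {k} → Bubbles k w → All (_< 2 + k) w
bubbles-< bw = All.map s≤s (All-resp-↭ (↭-sym (bubbles-↭ bw)) (desc≤ _))

-- A maximum in first place is released by the entry after it; one in second place overtakes the
-- held entry. Either way it comes out first and the pass continues on the smaller word.
∈bubblings⇒ : ∀ k → w ∈ bubblings k → Bubbles k w
∈bubblings⇒ zero    (here refl) = bubbles refl
∈bubblings⇒ (suc k) w∈ with ∈-++⁻ (map (2 + k ∷_) (bubblings k)) w∈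
... | inj₁ w∈₁ with v , v∈ , refl ← ∈-map⁻ (2 + k ∷_) w∈₁ = bubbles (atHead (∈bubblings⇒ k v∈))
  where
  atHead : Bubbles k w → bubble (2 + k) w ≡ desc (2 + k)
  atHead bw@(bubbles {l} eq) with 2 + k <? l
  ... | yes m<l = contradiction m<l (<-asym (All.head (bubbles-< bw)))
  ... | no  _   = cong (2 + k ∷_) eq
... | inj₂ w∈₂ with v , v∈ , refl ← ∈-map⁻ (insert₂ (2 + k)) w∈₂ = atSecond (∈bubblings⇒ k v∈)
  where
  atSecond : Bubbles k w → Bubbles (suc k) (insert₂ (2 + k) w)
  atSecond bw@(bubbles {l} {w} eq) = bubbles passed
    where
    passed : bubble l (2 + k ∷ w) ≡ desc (2 + k)
    passed with l <? 2 + k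
    ... | yes _   = cong (2 + k ∷_) eq
    ... | no  l≮m = contradiction (All.head (bubbles-< bw)) l≮m

bubble≢[] : ∀ l w → bubble l w ≢ []
bubble≢[] l w eq with () ← trans (sym (↭-length (bubble-↭ l w))) (cong length eq)

-- The first entry put out must be the maximum. It is `c` or `l` according to the comparison, which
-- locates the maximum in second or first place.
∈bubblings⇐ : ∀ k l w → bubble l w ≡ desc (suc k) → l ∷ w ∈ bubblings k
∈bubblings⇐ zero    l []      refl = here refl
∈bubblings⇐ k       l (c ∷ w) eq with l <? c
∈bubblings⇐ zero    l (c ∷ w) eq | yes _ = contradiction (∷-injectiveʳ eq) (bubble≢[] l w)
∈bubblings⇐ zero    l (c ∷ w) eq | no  _ = contradiction (∷-injectiveʳ eq) (bubble≢[] c w)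
∈bubblings⇐ (suc k) l (c ∷ w) eq | yes _ with refl ← ∷-injectiveˡ eq =
  ∈-++⁺ʳ _ (∈-map⁺ (insert₂ (2 + k)) (∈bubblings⇐ k l w (∷-injectiveʳ eq)))
∈bubblings⇐ (suc k) l (c ∷ w) eq | no  _ with refl ← ∷-injectiveˡ eq =
  ∈-++⁺ˡ (∈-map⁺ (2 + k ∷_) (∈bubblings⇐ k c w (∷-injectiveʳ eq)))

bubblings-unique : ∀ k → Unique (bubblings k)
bubblings-unique zero    = [] ∷ []
bubblings-unique (suc k) = Unique.++⁺ (Unique.map⁺ ∷-injectiveʳ (bubblings-unique k))
  (Unique.map⁺ insert₂-injective (bubblings-unique k)) disjoint
  where
  disjoint : Disjoint (map (2 + k ∷_) (bubblings k)) (map (insert₂ (2 + k)) (bubblings k))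
  disjoint (w∈₁ , w∈₂) with ∈-map⁻ (2 + k ∷_) w∈₁ | ∈-map⁻ (insert₂ (2 + k)) w∈₂
  ... | u , _ , refl | v , v∈ , eq with ∈bubblings⇒ k v∈
  ... | bv@(bubbles _) with refl ← ∷-injectiveˡ eq = <-irrefl refl (All.head (bubbles-< bv))

length-bubblings : ∀ k → length (bubblings k) ≡ 2 ^ k
length-bubblings zero    = refl
length-bubblings (suc k) = trans (length-++ (map (2 + k ∷_) (bubblings k)))
  (cong₂ _+_ (trans (length-map _ (bubblings k)) (length-bubblings k))
             (trans (trans (length-map _ (bubblings k)) (length-bubblings k)) (sym (+-identityʳ (2 ^ k)))))

-- The three families of sortable permutations

opaque
  run₂ : Word → Word → Word
  run₂ = run T₂₁

  run₂-def : run₂ x st ≡ run T₂₁ x st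
  run₂-def = refl

  run₂-[] : run₂ [] st ≡ st
  run₂-[] = refl

  run₂-push : AllPairs _<_ (a ∷ st) → run₂ (a ∷ x) st ≡ run₂ x (a ∷ st)
  run₂-push inc = run-push (increasing⇒avoids₂₁ inc)

  run₂-pop : ∀ {t} → t < a → run₂ (a ∷ x) (t ∷ st) ≡ t ∷ run₂ (a ∷ x) st
  run₂-pop {x = x} {st = st} t<a = run-pop {st = st} {x = x} λ av → avoids₂₁⇒≮ av (refl ∷ refl ∷ minimum _) t<a

-- Each entry of the decreasing run is below the whole stack, so all are pushed and end up reversed.
run₂-push-desc : ∀ m → AllPairs _<_ st → All (m <_) st → run₂ (desc m ++ r) st ≡ run₂ r (identity m ++ st)
run₂-push-desc zero    _   _    = refl
run₂-push-desc {st} {r} (suc m) inc m<st =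
  trans (run₂-push (m<st ∷ inc))
    (trans (run₂-push-desc m (m<st ∷ inc) (≤-refl ∷ All.map (<-trans (n<1+n m)) m<st))
      (cong (run₂ r) (trans (sym (++-assoc (identity m) _ st)) (cong (_++ st) (sym (identity-∷ʳ m))))))

run₂-pop-all : ∀ x → All (_< a) x → run₂ (a ∷ r) (x ++ st) ≡ x ++ run₂ (a ∷ r) st
run₂-pop-all []      []          = refl
run₂-pop-all (t ∷ x) (t<a ∷ x<a) = trans (run₂-pop t<a) (cong (t ∷_) (run₂-pop-all x x<a))

identity≤ : ∀ n → All (_≤ n) (identity n)
identity≤ n = All-resp-↭ (desc↭identity n) (desc≤ n)

run₂-desc : ∀ m → AllPairs _<_ st → All (m <_) st → m < a → run₂ (desc m ++ a ∷ r) st ≡ identity m ++ run₂ (a ∷ r) st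
run₂-desc m inc m<st m<a = trans (run₂-push-desc m inc m<st)
  (run₂-pop-all (identity m) (All.map (λ i≤m → ≤-<-trans i≤m m<a) (identity≤ m)))

identity-∷ʳ² : ∀ m → identity m ++ 1 + m ∷ 2 + m ∷ [] ≡ identity (2 + m)
identity-∷ʳ² m = trans (sym (++-assoc (identity m) _ _))
  (trans (cong (_++ 2 + m ∷ []) (sym (identity-∷ʳ m))) (sym (identity-∷ʳ (suc m))))

-- This and the next two lemmas sort the outputs of the three families. In `west₃` the maximum waits
-- at the bottom while the decreasing run passes over it.
west₁ : ∀ m → run₂ (desc m ++ 1 + m ∷ []) [] ≡ identity (1 + m)
west₁ m = trans (run₂-desc m [] [] ≤-refl)
  (trans (cong (identity m ++_) (trans (run₂-push ([] ∷ [])) run₂-[])) (sym (identity-∷ʳ m)))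

west₂ : ∀ m → run₂ (desc m ++ 2 + m ∷ 1 + m ∷ []) [] ≡ identity (2 + m)
west₂ m = trans (run₂-desc m [] [] (m≤n⇒m≤1+n ≤-refl))
  (trans (cong (identity m ++_) (trans (run₂-push ([] ∷ [])) (trans (run₂-push ((≤-refl ∷ []) ∷ [] ∷ [])) run₂-[])))
    (identity-∷ʳ² m))

west₃ : ∀ m → run₂ (2 + m ∷ desc m ++ 1 + m ∷ []) [] ≡ identity (2 + m)
west₃ m = trans (run₂-push ([] ∷ [])) (trans (run₂-desc m ([] ∷ []) (m≤n⇒m≤1+n ≤-refl ∷ []) ≤-refl)
  (trans (cong (identity m ++_) (trans (run₂-push ((≤-refl ∷ []) ∷ [] ∷ [])) run₂-[])) (identity-∷ʳ² m)))

unique-resp-↭ : y ↭ x → Unique x → Unique y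
unique-resp-↭ p = Permutationₛ.Unique-resp-↭ (setoid ℕ) (↭⇒↭ₛ (↭-sym p))

identity-unique : ∀ n → Unique (identity n)
identity-unique n = AllPairs.map <⇒≢ (identity-increasing n)

bubbles-unique : ∀ {k} → Bubbles k w → Unique w
bubbles-unique {k = k} bw = unique-resp-↭ (↭-trans (bubbles-↭ bw) (desc↭identity _)) (identity-unique (suc k))

family₁ family₂ family₃ : ℕ → Word → Word
family₁ k w = 4 + k ∷ w
family₂ k w = 3 + k ∷ 4 + k ∷ w
family₃ k w = 3 + k ∷ 2 + k ∷ 4 + k ∷ w

sortables : ℕ → List Word
sortables k = map (family₁ k) (bubblings (2 + k)) ++ map (family₂ k) (bubblings (1 + k)) ++ map (family₃ k) (bubblings k)

Sortable : ℕ → Word → Set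
Sortable k = Sort (4 + k) (1 ∷ 2 ∷ 3 ∷ []) (3 ∷ 2 ∷ 1 ∷ [])

sort⁺ : ∀ {k z} → x ↭ desc (4 + k) → run₃ x [] ≡ z → run₂ z [] ≡ identity (4 + k) → Sortable k x
sort⁺ {x} {k} {z} p eq₃ eq₂ = ↭-trans p (desc↭identity _) ,
  trans (cong West (trans (sym run₃-def) eq₃)) (trans (sym run₂-def) eq₂)

family₁-sorts : ∀ k → Bubbles (2 + k) w → Sortable k (family₁ k w)
family₁-sorts k bw@(bubbles {l} {w} eq) with l<n ∷ w<n ← bubbles-< bw = sort⁺
  (prep _ (bubbles-↭ bw))
  (trans (run₃-push (avoids₁ _)) (trans (run₃-push (avoids₂ _ _))
    (trans (run₃≡bubble alone l w l<n w<n (bubbles-unique bw)) (cong (_++ _) eq))))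
  (west₁ (3 + k))

family₂-sorts : ∀ k → Bubbles (1 + k) w → Sortable k (family₂ k w)
family₂-sorts k bw@(bubbles {l} {w} eq) with l<n ∷ w<n ← bubbles-< bw = sort⁺
  (swap _ _ (bubbles-↭ bw))
  (trans (run₃-push (avoids₁ _)) (trans (run₃-push (avoids₂ _ _)) (trans (run₃-push (base-avoids₁ (under ≤-refl) l<n))
    (trans (run₃≡bubble (under ≤-refl) l w l<n w<n (bubbles-unique bw)) (cong (_++ _) eq)))))
  (west₂ (2 + k))

family₃-sorts : ∀ k → Bubbles k w → Sortable k (family₃ k w)
family₃-sorts k bw@(bubbles {l} {w} eq) with l<n ∷ w<n ← bubbles-< bw = sort⁺
  (↭-trans (prep _ (swap _ _ ↭-refl)) (swap _ _ (prep _ (bubbles-↭ bw))))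
  (trans (run₃-push (avoids₁ _)) (trans (run₃-push (avoids₂ _ _)) (trans (step-over ≤-refl ≤-refl l<n)
    -- The base here is `3 + k`, one more than the bound `2 + k` from `bubbles-<`, so both bounds
    -- are weakened by one.
    (cong (λ z → 4 + k ∷ 2 + k ∷ z) (trans (run₃≡bubble alone l w (m≤n⇒m≤1+n l<n) (All.map m≤n⇒m≤1+n w<n) (bubbles-unique bw))
      (cong (_++ _) eq))))))
  (west₃ (2 + k))

-- Enumeration and count

sortables-sound : ∀ k → x ∈ sortables k → Sortable k x
sortables-sound k x∈ with ∈-++⁻ (map (family₁ k) (bubblings (2 + k))) x∈
... | inj₁ x∈₁ with w , w∈ , refl ← ∈-map⁻ (family₁ k) x∈₁ = family₁-sorts k (∈bubblings⇒ _ w∈)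
... | inj₂ x∈₂₃ with ∈-++⁻ (map (family₂ k) (bubblings (1 + k))) x∈₂₃
... | inj₁ x∈₂ with w , w∈ , refl ← ∈-map⁻ (family₂ k) x∈₂ = family₂-sorts k (∈bubblings⇒ _ w∈)
... | inj₂ x∈₃ with w , w∈ , refl ← ∈-map⁻ (family₃ k) x∈₃ = family₃-sorts k (∈bubblings⇒ _ w∈)

-- The decreasing word of the shape equals `desc (4 + k)`; its leading entries give the prefix of
-- the family, and the remainder is the bubble equation for the tail.
shape⇒∈sortables : ∀ k → x ↭ desc (4 + k) → Shape x → x ∈ sortables k
shape⇒∈sortables k p (shape₁ {b} {l} {w} dec)
  with eq ← decreasing↭desc (4 + k) _ dec (↭-trans (prep _ (bubble-↭ l w)) p)
  with refl ← ∷-injectiveˡ eq = ∈-++⁺ˡ (∈-map⁺ (family₁ k) (∈bubblings⇐ _ l w (∷-injectiveʳ eq)))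
shape⇒∈sortables k p (shape₂ {h} {b} {l} {w} dec)
  with eq ← decreasing↭desc (4 + k) _ dec (↭-trans (swap _ _ (bubble-↭ l w)) p)
  with refl ← ∷-injectiveˡ eq | eq′ ← ∷-injectiveʳ eq
  with refl ← ∷-injectiveˡ eq′ =
  ∈-++⁺ʳ (map (family₁ k) (bubblings (2 + k))) (∈-++⁺ˡ (∈-map⁺ (family₂ k) (∈bubblings⇐ _ l w (∷-injectiveʳ eq′))))
shape⇒∈sortables k p (shape₃ {h} {b} {l} {c} {w} dec)
  with eq ← decreasing↭desc (4 + k) _ dec (↭-trans (↭-trans (swap _ _ (prep _ (bubble-↭ c w))) (prep _ (swap _ _ ↭-refl))) p)
  with refl ← ∷-injectiveˡ eq | eq′ ← ∷-injectiveʳ eq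
  with refl ← ∷-injectiveˡ eq′ | eq″ ← ∷-injectiveʳ eq′
  with refl ← ∷-injectiveˡ eq″ =
  ∈-++⁺ʳ (map (family₁ k) (bubblings (2 + k))) (∈-++⁺ʳ (map (family₂ k) (bubblings (1 + k)))
    (∈-map⁺ (family₃ k) (∈bubblings⇐ _ c w (∷-injectiveʳ eq″))))

sortables-complete : ∀ k → Sortable k x → x ∈ sortables k
sortables-complete {x} k (p , sorted) = shape⇒∈sortables k (↭-trans p (↭-sym (desc↭identity _)))
  (sortable⇒shape x (unique-resp-↭ p (identity-unique (4 + k))) len
    (subst Avoids231 (sym run₃-def) (west-sorted⇒avoids231 (s[ T₃ ] x) sorted)))
  where
  len : length x ≥ 4
  len = subst (_≥ 4) (sym (trans (↭-length p) (trans (length-map suc (upTo (4 + k))) (length-upTo (4 + k))))) (m≤m+n 4 k)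

-- The first entry separates the first family from the other two, and the second entry separates
-- those.
sortables-unique : ∀ k → Unique (sortables k)
sortables-unique k = Unique.++⁺ (Unique.map⁺ (λ { refl → refl }) (bubblings-unique (2 + k)))
  (Unique.++⁺ (Unique.map⁺ (λ { refl → refl }) (bubblings-unique (1 + k)))
    (Unique.map⁺ (λ { refl → refl }) (bubblings-unique k)) disjoint₂₃)
  disjoint₁
  where
  disjoint₂₃ : Disjoint (map (family₂ k) (bubblings (1 + k))) (map (family₃ k) (bubblings k))
  disjoint₂₃ (x∈₂ , x∈₃) with ∈-map⁻ (family₂ k) x∈₂ | ∈-map⁻ (family₃ k) x∈₃
  ... | _ , _ , refl | _ , _ , ()
  disjoint₁ : Disjoint (map (family₁ k) (bubblings (2 + k))) (map (family₂ k) (bubblings (1 + k)) ++ map (family₃ k) (bubblings k))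
  disjoint₁ (x∈₁ , x∈₂₃) with ∈-map⁻ (family₁ k) x∈₁ | ∈-++⁻ (map (family₂ k) (bubblings (1 + k))) x∈₂₃
  ... | _ , _ , refl | inj₁ x∈₂ with _ , _ , () ← ∈-map⁻ (family₂ k) x∈₂
  ... | _ , _ , refl | inj₂ x∈₃ with _ , _ , () ← ∈-map⁻ (family₃ k) x∈₃

length-sortables : ∀ k → length (sortables k) ≡ 7 * 2 ^ k
length-sortables k = trans (length-++ (map (family₁ k) (bubblings (2 + k))))
  (trans (cong₂ _+_ (count (family₁ k) (2 + k)) (trans (length-++ (map (family₂ k) (bubblings (1 + k))))
    (cong₂ _+_ (count (family₂ k) (1 + k)) (count (family₃ k) k)))) (arith (2 ^ k)))
  where
  count : ∀ (f : Word → Word) j → length (map f (bubblings j)) ≡ 2 ^ j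
  count f j = trans (length-map f (bubblings j)) (length-bubblings j)
  arith : ∀ p → 2 * (2 * p) + (2 * p + p) ≡ 7 * p
  arith = solve-∀

theorem1p2 : (n : ℕ) → n ≥ 4 → HasCardinality (Sort n (1 ∷ 2 ∷ 3 ∷ []) (3 ∷ 2 ∷ 1 ∷ [])) (7 * 2 ^ (n ∸ 4))
theorem1p2 (suc (suc (suc (suc k)))) _ =
  sortables k , sortables-unique k , (λ _ → mk⇔ (sortables-sound k) (sortables-complete k)) , length-sortables k
theorem1p2 (suc (suc (suc zero))) (s≤s (s≤s (s≤s ())))
theorem1p2 (suc (suc zero)) (s≤s (s≤s ()))
theorem1p2 (suc zero) (s≤s ())
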